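{- Let $X=\{a,b\}$. Let $u$ be a nonempty finite non-periodic word over $X$, let $W=u^\infty$, and suppose that $W$ has exactly $n$ finite forks. Then $|u|\le F(n+1)$.
   Context: A nonempty finite word $u$ is periodic if $u=v^m$ for some word $v$ and some $m\ge2$, and non-periodic otherwise; $|u|$ denotes its length. $W=u^\infty=\dots uuu\dots$ is the two-sided infinite periodic word with period $u$. A finite word $v$ (possibly empty) is a subword of $W$ if it occurs in $W$. A finite fork of $W$ is a finite word $v$ such that all four words $va$, $vb$, $av$, $bv$ are subwords of $W$. The Fibonacci numbers are defined by $F(0)=F(1)=1$ and $F(m+1)=F(m)+F(m-1)$. -}

module Defs where

open import Data.Nat using (ℕ; zero; suc; _+_; _≥_)
open import Data.List using (List; []; _∷_; _++_; concat; replicate; length)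
open import Data.List.Membership.Propositional using (_∈_)
open import Data.List.Relation.Unary.Unique.Propositional using (Unique)
open import Data.Product using (Σ; ∃; _×_; _,_)
open import Relation.Binary.PropositionalEquality using (_≡_)
open import Relation.Nullary using (¬_)

data X : Set where
  a b : X

Word : Set
Word = List X

_^ʷ_ : Word → ℕ → Word
u ^ʷ m = concat (replicate m u)

Periodic : Word → Set
Periodic u = Σ Word λ v → Σ ℕ λ m → (m ≥ 2) × (u ≡ v ^ʷ m)

NonPeriodic : Word → Set
NonPeriodic u = ¬ Periodic u

-- v is a subword (factor) of the two-sided infinite word W = u^∞.
-- A finite window of u^∞ lies inside some finite power u^k, so
-- v occurs in u^∞ iff v occurs in u^k for some k.
SubwordOfPow∞ : Word → Word → Set
SubwordOfPow∞ u v = Σ ℕ λ k → Σ Word λ p → Σ Word λ s → p ++ v ++ s ≡ u ^ʷ k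

Fork : Word → Word → Set
Fork u v = SubwordOfPow∞ u (v ++ a ∷ [])
         × SubwordOfPow∞ u (v ++ b ∷ [])
         × SubwordOfPow∞ u (a ∷ v)
         × SubwordOfPow∞ u (b ∷ v)

HasExactlyForks : Word → ℕ → Set
HasExactlyForks u n =
  Σ (List Word) λ L → Unique L × length L ≡ n × (∀ v → (Fork u v → v ∈ L) × (v ∈ L → Fork u v))

F : ℕ → ℕ
F zero = 1
F (suc zero) = 1
F (suc (suc m)) = F (suc m) + F m

-- View W as a stream f of period p = |u| in which windows of some length separate
-- the positions mod p, and take a longest window w that occurs at two positions
-- incongruent mod p, at distance d say.  Then w is a longest fork, and cutting u
-- at the two occurrences of w yields cyclic words of sizes d and p - d all of whose
-- forks are forks of W other than w.
-- If one piece misses a further fork, induction gives |u| ≤ F(n) + F(n-1).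
-- Otherwise both pieces have the same forks.  A cyclic word of size q has q - 1 right
-- special words (the branching nodes of a binary trie with q leaves), and these are
-- the suffixes of its forks.  Hence d = p - d, and p ≤ d + |w|; so w is at least as long
-- as the common period of the pieces, which forces its two occurrences to extend
-- by the same letter, contradicting maximality.
module Submission where

open import Defs
open import Data.Nat using (ℕ; zero; suc; _+_; _*_; _∸_; _≤_; _<_; z≤n; s≤s; z<s; NonZero; >-nonZero; >-nonZero⁻¹)
open import Data.Nat.Properties
open import Data.Nat.DivMod
open import Data.Nat.Divisibility using (divides; ∣⇒≤)
open import Data.Nat.GCD using (gcd; gcd[m,n]∣m; gcd[m,n]∣n; gcd-GCD; module Bézout)
open import Data.Nat.Induction using (<-rec)
open import Data.Nat.Tactic.RingSolver using (solve-∀)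
open import Data.List using (List; []; _∷_; _++_; length; map; filter; applyUpTo)
open import Data.List.Properties using (≡-dec; ∷-injective; ∷-injectiveʳ; length-applyUpTo; length-++; length-map; ++-assoc; ++-identityʳ; filter-notAll)
open import Data.List.Membership.Propositional using (_∈_)
open import Data.List.Membership.Propositional.Properties
open import Data.List.Relation.Unary.All as All using (All; []; _∷_)
import Data.List.Relation.Unary.All.Properties as All
open import Data.List.Relation.Unary.AllPairs using ([]; _∷_)
open import Data.List.Relation.Unary.Any as Any using (here; there)
open import Data.List.Relation.Unary.Unique.Propositional using (Unique)
import Data.List.Relation.Unary.Unique.Propositional.Properties as Unique
open import Data.Product using (Σ; ∃; ∃₂; _×_; _,_; proj₁; proj₂)
open import Data.Sum using (_⊎_; inj₁; inj₂)
open import Data.Empty using (⊥; ⊥-elim)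
open import Function using (_∘_)
open import Relation.Nullary using (¬_; Dec; yes; no; contradiction)
open import Relation.Nullary.Decidable using (_×-dec_; ¬?; map′)
open import Relation.Binary.Definitions using (tri<; tri≈; tri>)
open import Relation.Binary.PropositionalEquality using (_≡_; _≢_; refl; sym; trans; cong; cong₂; subst; subst₂; ≢-sym; module ≡-Reasoning)

-- Letters and lists of words.

_≟ˣ_ : (x y : X) → Dec (x ≡ y)
a ≟ˣ a = yes refl
a ≟ˣ b = no λ ()
b ≟ˣ a = no λ ()
b ≟ˣ b = yes refl

_≟ʷ_ : (v w : Word) → Dec (v ≡ w)
_≟ʷ_ = ≡-dec _≟ˣ_

both-letters : ∀ {ℓ} (P : X → Set ℓ) {x y} → x ≢ y → P x → P y → P a × P b
both-letters P {a} {a} x≢y px py = contradiction refl x≢y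
both-letters P {a} {b} x≢y px py = px , py
both-letters P {b} {a} x≢y px py = py , px
both-letters P {b} {b} x≢y px py = contradiction refl x≢y

≢⇒≡ : ∀ {x y z : X} → x ≢ y → y ≢ z → x ≡ z
≢⇒≡ {a} {_} {a} _ _ = refl
≢⇒≡ {b} {_} {b} _ _ = refl
≢⇒≡ {a} {a} {b} x≢y _ = contradiction refl x≢y
≢⇒≡ {a} {b} {b} _ y≢z = contradiction refl y≢z
≢⇒≡ {b} {b} {a} x≢y _ = contradiction refl x≢y
≢⇒≡ {b} {a} {a} _ y≢z = contradiction refl y≢z

remove : Word → List Word → List Word
remove w = filter (λ v → ¬? (v ≟ʷ w))

length-remove : ∀ {w} L → w ∈ L → length (remove w L) < length L
length-remove L w∈L = filter-notAll _ L (Any.map (λ w≡v v≢w → v≢w (sym w≡v)) w∈L)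

∈-remove : ∀ {v w L} → v ∈ L → v ≢ w → v ∈ remove w L
∈-remove = ∈-filter⁺ _

Unique-⊆⇒length≤ : ∀ {xs ys : List Word} → Unique xs → (∀ {v} → v ∈ xs → v ∈ ys) → length xs ≤ length ys
Unique-⊆⇒length≤ {[]} _ _ = z≤n
Unique-⊆⇒length≤ {x ∷ xs} {ys} (x∉xs ∷ uxs) sub = ≤-trans
  (s≤s (Unique-⊆⇒length≤ uxs λ v∈xs → ∈-remove (sub (there v∈xs)) (≢-sym (All.lookup x∉xs v∈xs))))
  (length-remove ys (sub (here refl)))

-- Streams and their factors

Stream : Set
Stream = ℕ → X

shift : ℕ → Stream → Stream
shift i f t = f (i + t)

_startsWith_ : Stream → Word → Set
f startsWith v = applyUpTo f (length v) ≡ v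

applyUpTo-cong : ∀ {f g : Stream} n → (∀ t → t < n → f t ≡ g t) → applyUpTo f n ≡ applyUpTo g n
applyUpTo-cong zero _ = refl
applyUpTo-cong (suc n) eq = cong₂ _∷_ (eq 0 z<s) (applyUpTo-cong n λ t t<n → eq (suc t) (s≤s t<n))

applyUpTo-cong⁻ : ∀ {f g : Stream} n → applyUpTo f n ≡ applyUpTo g n → ∀ t → t < n → f t ≡ g t
applyUpTo-cong⁻ (suc n) eq zero _ = proj₁ (∷-injective eq)
applyUpTo-cong⁻ (suc n) eq (suc t) (s≤s t<n) = applyUpTo-cong⁻ n (∷-injectiveʳ eq) t t<n

applyUpTo-+ : (f : Stream) (m n : ℕ) → applyUpTo f (m + n) ≡ applyUpTo f m ++ applyUpTo (shift m f) n
applyUpTo-+ f zero n = refl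
applyUpTo-+ f (suc m) n = cong (f 0 ∷_) (applyUpTo-+ (f ∘ suc) m n)

startsWith-resp : ∀ {f g v} → (∀ t → t < length v → f t ≡ g t) → f startsWith v → g startsWith v
startsWith-resp {v = v} eq fv = trans (sym (applyUpTo-cong (length v) eq)) fv

startsWith-agree : ∀ {f g v} → f startsWith v → g startsWith v → ∀ t → t < length v → f t ≡ g t
startsWith-agree {v = v} fv gv = applyUpTo-cong⁻ (length v) (trans fv (sym gv))

startsWith-applyUpTo : (f : Stream) (n : ℕ) → f startsWith applyUpTo f n
startsWith-applyUpTo f n = cong (applyUpTo f) (length-applyUpTo f n)

startsWith-prefix : ∀ f v s n → v ++ s ≡ applyUpTo f n → f startsWith v
startsWith-prefix f [] s n eq = refl
startsWith-prefix f (x ∷ v) s (suc n) eq =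
  cong₂ _∷_ (sym (proj₁ (∷-injective eq))) (startsWith-prefix (f ∘ suc) v s n (∷-injectiveʳ eq))

startsWith-extend : ∀ f v n → length v ≤ n → f startsWith v → ∃ λ s → v ++ s ≡ applyUpTo f n
startsWith-extend f v n |v|≤n fv = applyUpTo (shift (length v) f) (n ∸ length v) , (begin
  v ++ applyUpTo (shift (length v) f) (n ∸ length v)                      ≡⟨ cong (_++ applyUpTo (shift (length v) f) (n ∸ length v)) (sym fv) ⟩
  applyUpTo f (length v) ++ applyUpTo (shift (length v) f) (n ∸ length v) ≡⟨ sym (applyUpTo-+ f (length v) _) ⟩
  applyUpTo f (length v + (n ∸ length v))                                 ≡⟨ cong (applyUpTo f) (m+[n∸m]≡n |v|≤n) ⟩
  applyUpTo f n                                                           ∎)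
  where open ≡-Reasoning

length-∷ʳ : (v : Word) (x : X) → length (v ++ x ∷ []) ≡ suc (length v)
length-∷ʳ v x = trans (length-++ v) (+-comm (length v) 1)

startsWith-∷ʳ⁺ : ∀ f v {x} → f startsWith v → f (length v) ≡ x → f startsWith (v ++ x ∷ [])
startsWith-∷ʳ⁺ f [] fv fx = cong (_∷ []) fx
startsWith-∷ʳ⁺ f (y ∷ v) fv fx =
  cong₂ _∷_ (proj₁ (∷-injective fv)) (startsWith-∷ʳ⁺ (f ∘ suc) v (∷-injectiveʳ fv) fx)

startsWith-∷ʳ⁻ : ∀ f v {x} → f startsWith (v ++ x ∷ []) → f (length v) ≡ x
startsWith-∷ʳ⁻ f [] fv = proj₁ (∷-injective fv)
startsWith-∷ʳ⁻ f (y ∷ v) fv = startsWith-∷ʳ⁻ (f ∘ suc) v (∷-injectiveʳ fv)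

-- A one-sided stream can stand for the two-sided word: under a period every occurrence can be moved
-- to the right, so natural positions suffice.
Occ : Stream → Word → Set
Occ f v = ∃ λ i → shift i f startsWith v

RightSpecial : Stream → Word → Set
RightSpecial f v = Occ f (v ++ a ∷ []) × Occ f (v ++ b ∷ [])

ForkOf : Stream → Word → Set
ForkOf f v = RightSpecial f v × Occ f (a ∷ v) × Occ f (b ∷ v)

Occ-shift : ∀ f i {v} → Occ (shift i f) v → Occ f v
Occ-shift f i (j , eq) = i + j , startsWith-resp {shift j (shift i f)} (λ t _ → cong f (sym (+-assoc i j t))) eq

Occ-suffix : ∀ f y {v} → Occ f (y ++ v) → Occ f v
Occ-suffix f [] o = o
Occ-suffix f (x ∷ y) (i , eq) =
  Occ-suffix f y (suc i , startsWith-resp {shift i f ∘ suc} (λ t _ → cong f (+-suc i t)) (∷-injectiveʳ eq))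

RightSpecial-suffix : ∀ f y {v} → RightSpecial f (y ++ v) → RightSpecial f v
RightSpecial-suffix f y {v} (oa , ob) =
  Occ-suffix f y (subst (Occ f) (++-assoc y v _) oa) , Occ-suffix f y (subst (Occ f) (++-assoc y v _) ob)

ForkOf-shift : ∀ f i {v} → ForkOf (shift i f) v → ForkOf f v
ForkOf-shift f i ((va , vb) , av , bv) =
  (Occ-shift f i va , Occ-shift f i vb) , Occ-shift f i av , Occ-shift f i bv

-- Periodic streams

HasPeriod : ℕ → Stream → Set
HasPeriod p f = ∀ t → f (p + t) ≡ f t

period-* : ∀ {p f} → HasPeriod p f → ∀ n t → f (n * p + t) ≡ f t
period-* per zero t = refl
period-* {p} {f} per (suc n) t =
  trans (cong f (+-assoc p (n * p) t)) (trans (per (n * p + t)) (period-* per n t))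

period-shift : ∀ {p f} i → HasPeriod p f → HasPeriod p (shift i f)
period-shift {p} {f} i per t = trans (cong f (lemma i p t)) (per (i + t))
  where
  lemma : ∀ i p t → i + (p + t) ≡ p + (i + t)
  lemma = solve-∀

x+[y+z]≡y+x+z : ∀ x y z → x + (y + z) ≡ y + x + z
x+[y+z]≡y+x+z = solve-∀

-- Bézout over the naturals writes `gcd p q` plus a multiple of one period as a multiple of the
-- other; the two cases are the two signs.
period-gcd : ∀ {p q f} → HasPeriod p f → HasPeriod q f → HasPeriod (gcd p q) f
period-gcd {p} {q} {f} perp perq t with Bézout.identity (gcd-GCD p q)
... | Bézout.+- x y eq = begin
  f (gcd p q + t)           ≡⟨ sym (period-* perq y _) ⟩
  f (y * q + (gcd p q + t)) ≡⟨ cong f (x+[y+z]≡y+x+z (y * q) (gcd p q) t) ⟩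
  f (gcd p q + y * q + t)   ≡⟨ cong (λ s → f (s + t)) eq ⟩
  f (x * p + t)             ≡⟨ period-* perp x t ⟩
  f t                       ∎
  where open ≡-Reasoning
... | Bézout.-+ x y eq = begin
  f (gcd p q + t)           ≡⟨ sym (period-* perp x _) ⟩
  f (x * p + (gcd p q + t)) ≡⟨ cong f (x+[y+z]≡y+x+z (x * p) (gcd p q) t) ⟩
  f (gcd p q + x * p + t)   ≡⟨ cong (λ s → f (s + t)) eq ⟩
  f (y * q + t)             ≡⟨ period-* perq y t ⟩
  f t                       ∎
  where open ≡-Reasoning

applyUpTo-power : ∀ {p f} → HasPeriod p f → ∀ n → applyUpTo f (n * p) ≡ applyUpTo f p ^ʷ n
applyUpTo-power per zero = refl
applyUpTo-power {p} {f} per (suc n) = trans (applyUpTo-+ f p (n * p))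
  (cong (applyUpTo f p ++_)
    (trans (applyUpTo-cong (n * p) λ t _ → per t) (applyUpTo-power per n)))

-- Agreement of windows and separation of positions.

Agree : Stream → ℕ → ℕ → ℕ → Set
Agree f n i j = ∀ t → t < n → f (i + t) ≡ f (j + t)

Agree-sym : ∀ f {n i j} → Agree f n i j → Agree f n j i
Agree-sym f ag t t<n = sym (ag t t<n)

Agree? : ∀ f n i j → Dec (Agree f n i j)
Agree? f n i j = map′ (λ h t → h {t}) (λ h {t} → h t) (allUpTo? (λ t → f (i + t) ≟ˣ f (j + t)) n)

Agree-suc : ∀ {f n i j} → Agree f n i j → f (i + n) ≡ f (j + n) → Agree f (suc n) i j
Agree-suc ag eq t t<1+n with m<1+n⇒m<n∨m≡n t<1+n
... | inj₁ t<n  = ag t t<n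
... | inj₂ refl = eq

period-% : ∀ {p f} .{{_ : NonZero p}} → HasPeriod p f → ∀ i t → f (i % p + t) ≡ f (i + t)
period-% {p} {f} per i t = begin
  f (i % p + t)                   ≡⟨ sym (period-* per (i / p) _) ⟩
  f ((i / p) * p + (i % p + t))   ≡⟨ cong f (x+[y+z]≡y+x+z ((i / p) * p) (i % p) t) ⟩
  f (i % p + (i / p) * p + t)     ≡⟨ cong (λ s → f (s + t)) (sym (m≡m%n+[m/n]*n i p)) ⟩
  f (i + t)                       ∎
  where open ≡-Reasoning

Agree-% : ∀ {p f n i j} .{{_ : NonZero p}} → HasPeriod p f → Agree f n i j → Agree f n (i % p) (j % p)
Agree-% {i = i} {j} per ag t t<n = trans (period-% per i t) (trans (ag t t<n) (sym (period-% per j t)))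

-- Subtracting `n` modulo `p = suc q` is adding `n * q`, because `n * q + n` is a multiple of `p`.
%-cancelˡ-+ : ∀ n i j p .{{_ : NonZero p}} → (n + i) % p ≡ (n + j) % p → i % p ≡ j % p
%-cancelˡ-+ n i j p@(suc q) eq = begin
  i % p                               ≡⟨ expand i ⟩
  ((n * q) % p + (n + i) % p) % p     ≡⟨ cong (λ r → ((n * q) % p + r) % p) eq ⟩
  ((n * q) % p + (n + j) % p) % p     ≡⟨ sym (expand j) ⟩
  j % p                               ∎
  where
  open ≡-Reasoning
  lemma : ∀ n q i → i + n * suc q ≡ n * q + (n + i)
  lemma = solve-∀
  expand : ∀ i → i % p ≡ ((n * q) % p + (n + i) % p) % p
  expand i = begin
    i % p                             ≡⟨ sym ([m+kn]%n≡m%n i n p) ⟩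
    (i + n * p) % p                   ≡⟨ cong (_% p) (lemma n q i) ⟩
    (n * q + (n + i)) % p             ≡⟨ %-distribˡ-+ (n * q) (n + i) p ⟩
    ((n * q) % p + (n + i) % p) % p   ∎

%-injective-< : ∀ {i j p} .{{_ : NonZero p}} → i < p → j < p → i % p ≡ j % p → i ≡ j
%-injective-< i<p j<p eq = trans (sym (m<n⇒m%n≡m i<p)) (trans eq (m<n⇒m%n≡m j<p))

Separated : ℕ → (p : ℕ) → .{{NonZero p}} → Stream → Set
Separated n p f = ∀ i j → Agree f n i j → i % p ≡ j % p

Separated-shift : ∀ {n p f} i .{{_ : NonZero p}} → Separated n p f → Separated n p (shift i f)
Separated-shift {p = p} {f} i sep j k ag = %-cancelˡ-+ i j k p (sep (i + j) (i + k) λ t t<n →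
  trans (cong f (+-assoc i j t)) (trans (ag t t<n) (cong f (sym (+-assoc i k t)))))

-- Both positions are representatives below `p`, which makes the failure of separation a finite
-- search.
Coincidence : ℕ → ℕ → Stream → Set
Coincidence n p f = ∃ λ j → j < p × ∃ λ i → i < j × Agree f n i j

separated-or-coincidence : ∀ n p f .{{_ : NonZero p}} → HasPeriod p f → Separated n p f ⊎ Coincidence n p f
separated-or-coincidence n p f per with anyUpTo? (λ j → anyUpTo? (λ i → Agree? f n i j) j) p
... | yes c = inj₂ c
... | no ¬c = inj₁ sep
  where
  sep : Separated n p f
  sep i j ag with <-cmp (i % p) (j % p)
  ... | tri≈ _ eq _ = eq
  ... | tri< lt _ _ = contradiction (j % p , m%n<n j p , i % p , lt , Agree-% per ag) ¬c
  ... | tri> _ _ gt = contradiction (i % p , m%n<n i p , j % p , gt , Agree-sym f (Agree-% per ag)) ¬c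

-- The depth is lowered until separation first fails. This happens at depth 0 at the latest: empty
-- windows agree at 0 and 1, which are incongruent when `1 < p`.
longest-coincidence : ∀ n p f .{{_ : NonZero p}} → 1 < p → HasPeriod p f → Separated n p f →
  ∃ λ k → Separated (suc k) p f × Coincidence k p f
longest-coincidence zero p f 1<p per sep =
  contradiction (%-injective-< (<-trans z<s 1<p) 1<p (sep 0 1 λ _ ())) λ ()
longest-coincidence (suc n) p f 1<p per sep with separated-or-coincidence n p f per
... | inj₁ sep′ = longest-coincidence n p f 1<p per sep′
... | inj₂ c = n , sep , c

Occ-% : ∀ {p f v} .{{_ : NonZero p}} → HasPeriod p f → Occ f v → ∃ λ i → i < p × shift i f startsWith v
Occ-% {p} {f} per (i , eq) = i % p , m%n<n i p , startsWith-resp {shift i f} (λ t _ → sym (period-% per i t)) eq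

Occ? : ∀ {p f} .{{_ : NonZero p}} → HasPeriod p f → ∀ v → Dec (Occ f v)
Occ? {p} {f} per v = map′ (λ (i , _ , eq) → i , eq) (Occ-% per)
  (anyUpTo? (λ i → applyUpTo (shift i f) (length v) ≟ʷ v) p)

ForkOf? : ∀ {p f} .{{_ : NonZero p}} → HasPeriod p f → ∀ v → Dec (ForkOf f v)
ForkOf? per v = (Occ? per _ ×-dec Occ? per _) ×-dec Occ? per _ ×-dec Occ? per _

-- Right special words

-- Two occurrences of a word of length at least `n` start at congruent positions, so the same letter
-- would follow both.
RightSpecial-length : ∀ {n p f v} .{{_ : NonZero p}} → HasPeriod p f → Separated n p f →
  RightSpecial f v → length v < n
RightSpecial-length {n} {p} {f} {v} per sep ((i , va) , (j , vb)) = ≰⇒> λ n≤|v| →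
  contradiction (trans (sym (at i va)) (trans (same n≤|v|) (at j vb))) λ ()
  where
  at : ∀ i {x} → shift i f startsWith (v ++ x ∷ []) → f (i + length v) ≡ x
  at i = startsWith-∷ʳ⁻ (shift i f) v
  prefix : ∀ i {x} → shift i f startsWith (v ++ x ∷ []) → shift i f startsWith v
  prefix i {x} eq = startsWith-prefix _ v (x ∷ []) _ (sym eq)
  same : n ≤ length v → f (i + length v) ≡ f (j + length v)
  same n≤|v| = begin
    f (i + length v)       ≡⟨ sym (period-% per i _) ⟩
    f (i % p + length v)   ≡⟨ cong (λ r → f (r + length v)) (sep i j λ t t<n →
                                startsWith-agree (prefix i va) (prefix j vb) t (≤-trans t<n n≤|v|)) ⟩
    f (j % p + length v)   ≡⟨ period-% per j _ ⟩
    f (j + length v)       ∎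
    where open ≡-Reasoning

Occ-extend : ∀ {p f v} .{{_ : NonZero p}} → HasPeriod p f → Occ f v → ∃ λ x → Occ f (x ∷ v)
-- Position `q + i` is the one just before `suc q + i`, one period after `i`; this also covers
-- `i = 0`.
Occ-extend {suc q} {f} {v} per (i , eq) = f (q + i) , q + i ,
  cong₂ _∷_ (cong f (+-identityʳ (q + i)))
    (startsWith-resp {shift i f} (λ t _ → trans (sym (per (i + t))) (cong f (lemma q i t))) eq)
  where
  lemma : ∀ q i t → suc q + (i + t) ≡ q + i + suc t
  lemma = solve-∀

ForkWithSuffix : Stream → Word → Set
ForkWithSuffix f v = ∃₂ λ z y → ForkOf f z × y ++ v ≡ z

-- Extend to the left: if the same letter `x` precedes both occurrences, then `x ∷ v` is right
-- special again; if the letters differ, `v` is a fork. Right special words are shorter than `n`, so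
-- fuel `n` suffices.
RightSpecial⇒suffix-of-fork : ∀ {n p f v} .{{_ : NonZero p}} → HasPeriod p f → Separated n p f →
  RightSpecial f v → ForkWithSuffix f v
RightSpecial⇒suffix-of-fork {n} {p} {f} per sep = go n (m≤m+n n _)
  where
  go : ∀ fuel {v} → n ≤ fuel + length v → RightSpecial f v → ForkWithSuffix f v
  go zero n≤ rs = contradiction n≤ (<⇒≱ (RightSpecial-length per sep rs))
  go (suc fuel) {v} n≤ rs@(oa , ob) with Occ-extend per oa | Occ-extend per ob
  ... | x , xva | y , yvb with x ≟ˣ y
  ... | yes refl with go fuel (≤-trans n≤ (≤-reflexive (sym (+-suc fuel (length v))))) (xva , yvb)
  ... | z , s , fk , eq = z , s ++ x ∷ [] , fk , trans (++-assoc s (x ∷ []) v) eq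
  go (suc fuel) {v} n≤ rs | x , xva | y , yvb | no x≢y =
    v , [] , (rs , both-letters (λ c → Occ f (c ∷ v)) x≢y (drop xva) (drop yvb)) , refl
    where
    drop : ∀ {c d} → Occ f (c ∷ v ++ d ∷ []) → Occ f (c ∷ v)
    drop {c} {d} (i , eq) = i , startsWith-prefix (shift i f) (c ∷ v) (d ∷ []) _ (sym eq)

-- Counting right special words

-- The left quotient by `x`, that is, the subtrie below the child `x` of the root.
residual : X → List Word → List Word
residual x [] = []
residual x ([] ∷ ws) = residual x ws
residual x ((y ∷ w) ∷ ws) with x ≟ˣ y
... | yes _ = w ∷ residual x ws
... | no  _ = residual x ws

∈-residual⁺ : ∀ {x w} ws → x ∷ w ∈ ws → w ∈ residual x ws
∈-residual⁺ ([] ∷ ws) (there m) = ∈-residual⁺ ws m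
∈-residual⁺ {x} ((y ∷ v) ∷ ws) m with x ≟ˣ y | m
... | yes _  | here refl = here refl
... | yes _  | there m′  = there (∈-residual⁺ ws m′)
... | no x≢y | here refl = contradiction refl x≢y
... | no _   | there m′  = ∈-residual⁺ ws m′

∈-residual⁻ : ∀ {x w} ws → w ∈ residual x ws → x ∷ w ∈ ws
∈-residual⁻ ([] ∷ ws) m = there (∈-residual⁻ ws m)
∈-residual⁻ {x} ((y ∷ v) ∷ ws) m with x ≟ˣ y
∈-residual⁻ ((y ∷ v) ∷ ws) (here refl) | yes refl = here refl
∈-residual⁻ ((y ∷ v) ∷ ws) (there m)   | yes refl = there (∈-residual⁻ ws m)
∈-residual⁻ ((y ∷ v) ∷ ws) m           | no _     = there (∈-residual⁻ ws m)

residual-unique : ∀ x ws → Unique ws → Unique (residual x ws)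
residual-unique x [] _ = []
residual-unique x ([] ∷ ws) (_ ∷ u) = residual-unique x ws u
residual-unique x ((y ∷ w) ∷ ws) (∉ws ∷ u) with x ≟ˣ y
... | yes refl = All.tabulate (λ m w≡v → All.lookup ∉ws (∈-residual⁻ ws m) (cong (x ∷_) w≡v))
                   ∷ residual-unique x ws u
... | no _ = residual-unique x ws u

OfLength : ℕ → List Word → Set
OfLength n = All (λ w → length w ≡ n)

residual-ofLength : ∀ {n} x ws → OfLength (suc n) ws → OfLength n (residual x ws)
residual-ofLength x ws len = All.tabulate λ m → suc-injective (All.lookup len (∈-residual⁻ ws m))

length-residuals : ∀ {n} ws → OfLength (suc n) ws →
  length (residual a ws) + length (residual b ws) ≡ length ws
length-residuals [] _ = refl
length-residuals ((a ∷ w) ∷ ws) (_ ∷ len) = cong suc (length-residuals ws len)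
length-residuals ((b ∷ w) ∷ ws) (_ ∷ len) = trans (+-suc _ _) (cong suc (length-residuals ws len))

residuals-nonempty : ∀ {n w} ws → OfLength (suc n) ws → w ∈ ws → residual a ws ≡ [] → residual b ws ≡ [] → ⊥
residuals-nonempty {w = []}    ws len m _  _  = contradiction (All.lookup len m) λ ()
residuals-nonempty {w = a ∷ w} ws len m eᵃ _  = ∉[] (subst (w ∈_) eᵃ (∈-residual⁺ ws m))
residuals-nonempty {w = b ∷ w} ws len m _  eᵇ = ∉[] (subst (w ∈_) eᵇ (∈-residual⁺ ws m))

-- The nodes with two children in the trie of `ws`.
Branching : List Word → Word → Set
Branching ws v = ∀ x → ∃ λ s → v ++ x ∷ s ∈ ws

Branching-∷⁺ : ∀ {x v} ws → Branching (residual x ws) v → Branching ws (x ∷ v)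
Branching-∷⁺ ws br y with s , m ← br y = s , ∈-residual⁻ ws m

Branching-∷⁻ : ∀ {x v} ws → Branching ws (x ∷ v) → Branching (residual x ws) v
Branching-∷⁻ ws br y with s , m ← br y = s , ∈-residual⁺ ws m

-- With one subtrie empty, the root does not branch and no branching node lies below the missing
-- child.
Branching-one-sided : ∀ {x y v} ws → x ≢ y → residual y ws ≡ [] → Branching ws v →
  ∃ λ v′ → v ≡ x ∷ v′ × Branching (residual x ws) v′
Branching-one-sided {x} {y} {[]} ws x≢y ey br with s , m ← br y =
  ⊥-elim (∉[] (subst (s ∈_) ey (∈-residual⁺ ws m)))
Branching-one-sided {x} {y} {c ∷ v} ws x≢y ey br with c ≟ˣ x
... | yes refl = v , refl , Branching-∷⁻ ws br
... | no c≢x with s , m ← br y =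
  ⊥-elim (∉[] (subst (v ++ y ∷ s ∈_) ey
    (∈-residual⁺ ws (subst (λ z → z ∷ v ++ y ∷ s ∈ ws) (≢⇒≡ c≢x x≢y) m))))

-- Note the shift: P holds for exactly n - 1 words.
Enumeration : (Word → Set) → ℕ → Set
Enumeration P n = Σ (List Word) λ R →
  Unique R × suc (length R) ≡ n × (∀ {v} → v ∈ R → P v) × (∀ {v} → P v → v ∈ R)

enumeration-cong : ∀ {P Q n} → (∀ {v} → P v → Q v) → (∀ {v} → Q v → P v) → Enumeration P n → Enumeration Q n
enumeration-cong to from (R , u , len , ⇒ , ⇐) = R , u , len , to ∘ ⇒ , ⇐ ∘ from

enumeration-∷ : ∀ x {P Q n} → (∀ {v} → P v → Q (x ∷ v)) → (∀ {v} → Q v → ∃ λ v′ → v ≡ x ∷ v′ × P v′) →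
  Enumeration P n → Enumeration Q n
enumeration-∷ x {P} {Q} to from (R , u , len , ⇒ , ⇐) =
  map (x ∷_) R , Unique.map⁺ ∷-injectiveʳ u , trans (cong suc (length-map (x ∷_) R)) len , sound , complete
  where
  sound : ∀ {v} → v ∈ map (x ∷_) R → Q v
  sound m with v′ , m′ , refl ← ∈-map⁻ (x ∷_) m = to (⇒ m′)
  complete : ∀ {v} → Q v → v ∈ map (x ∷_) R
  complete q with v′ , refl , p ← from q = ∈-map⁺ (x ∷_) (⇐ p)

-- The root is one more branching node: `(k - 1) + (l - 1) + 1 = (k + l) - 1`, so the shifted counts
-- add.
enumeration-join : ∀ {Q k l} {Pᵃ Pᵇ : Word → Set} →
  (∀ {v} → Pᵃ v → Q (a ∷ v)) → (∀ {v} → Q (a ∷ v) → Pᵃ v) →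
  (∀ {v} → Pᵇ v → Q (b ∷ v)) → (∀ {v} → Q (b ∷ v) → Pᵇ v) → Q [] →
  Enumeration Pᵃ k → Enumeration Pᵇ l → Enumeration Q (k + l)
enumeration-join {Q} {k} {l} toᵃ fromᵃ toᵇ fromᵇ q[] (Rᵃ , uᵃ , lenᵃ , ⇒ᵃ , ⇐ᵃ) (Rᵇ , uᵇ , lenᵇ , ⇒ᵇ , ⇐ᵇ) =
  R , unique , count , sound , complete
  where
  aRᵃ = map (a ∷_) Rᵃ
  bRᵇ = map (b ∷_) Rᵇ
  R = [] ∷ aRᵃ ++ bRᵇ
  []∉ : ∀ {v} → v ∈ aRᵃ ++ bRᵇ → [] ≢ v
  []∉ m refl with ∈-++⁻ aRᵃ m
  ... | inj₁ m′ with () ← proj₂ (proj₂ (∈-map⁻ (a ∷_) m′))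
  ... | inj₂ m′ with () ← proj₂ (proj₂ (∈-map⁻ (b ∷_) m′))
  disjoint : ∀ {v} → ¬ (v ∈ aRᵃ × v ∈ bRᵇ)
  disjoint (m , m′) with _ , _ , refl ← ∈-map⁻ (a ∷_) m with () ← proj₂ (proj₂ (∈-map⁻ (b ∷_) m′))
  unique : Unique R
  unique = All.tabulate []∉ ∷ Unique.++⁺ (Unique.map⁺ ∷-injectiveʳ uᵃ) (Unique.map⁺ ∷-injectiveʳ uᵇ) disjoint
  count : suc (length R) ≡ k + l
  count = begin
    2 + length (aRᵃ ++ bRᵇ)               ≡⟨ cong (2 +_) (length-++ aRᵃ) ⟩
    2 + (length aRᵃ + length bRᵇ)         ≡⟨ cong₂ (λ i j → 2 + (i + j)) (length-map _ Rᵃ) (length-map _ Rᵇ) ⟩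
    2 + (length Rᵃ + length Rᵇ)           ≡⟨ cong suc (sym (+-suc (length Rᵃ) (length Rᵇ))) ⟩
    suc (length Rᵃ) + suc (length Rᵇ)     ≡⟨ cong₂ _+_ lenᵃ lenᵇ ⟩
    k + l                                 ∎
    where open ≡-Reasoning
  sound : ∀ {v} → v ∈ R → Q v
  sound (here refl) = q[]
  sound (there m) with ∈-++⁻ aRᵃ m
  ... | inj₁ m′ with _ , m″ , refl ← ∈-map⁻ (a ∷_) m′ = toᵃ (⇒ᵃ m″)
  ... | inj₂ m′ with _ , m″ , refl ← ∈-map⁻ (b ∷_) m′ = toᵇ (⇒ᵇ m″)
  complete : ∀ {v} → Q v → v ∈ R
  complete {[]} _ = here refl
  complete {a ∷ v} q = there (∈-++⁺ˡ (∈-map⁺ (a ∷_) (⇐ᵃ (fromᵃ q))))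
  complete {b ∷ v} q = there (∈-++⁺ʳ aRᵃ (∈-map⁺ (b ∷_) (⇐ᵇ (fromᵇ q))))

empty-or-member : (ws : List Word) → ws ≡ [] ⊎ ∃ (_∈ ws)
empty-or-member [] = inj₁ refl
empty-or-member (w ∷ ws) = inj₂ (w , here refl)

-- A binary trie with n leaves has n - 1 branching nodes.
branching-enumeration : ∀ n ws → Unique ws → OfLength n ws → ∃ (_∈ ws) → Enumeration (Branching ws) (length ws)
branching-enumeration zero (w ∷ []) u len _ = [] , [] , refl , (λ ()) , no-branching
  where
  no-branching : ∀ {v} → Branching (w ∷ []) v → v ∈ []
  no-branching {[]}    br = contradiction (All.lookup len (proj₂ (br a))) λ ()
  no-branching {_ ∷ v} br = contradiction (All.lookup len (proj₂ (br a))) λ ()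
branching-enumeration zero ([] ∷ [] ∷ ws) ((≢ ∷ _) ∷ _) (_ ∷ _ ∷ _) _ = contradiction refl ≢
branching-enumeration (suc n) ws u len (w , w∈ws)
  with empty-or-member (residual a ws) | empty-or-member (residual b ws)
... | inj₁ eᵃ | inj₁ eᵇ = ⊥-elim (residuals-nonempty ws len w∈ws eᵃ eᵇ)
... | inj₁ eᵃ | inj₂ mᵇ =
  subst (Enumeration (Branching ws))
    (trans (cong (λ rs → length rs + length (residual b ws)) (sym eᵃ)) (length-residuals ws len))
    (enumeration-∷ b (Branching-∷⁺ ws) (Branching-one-sided ws (λ ()) eᵃ)
      (branching-enumeration n (residual b ws) (residual-unique b ws u) (residual-ofLength b ws len) mᵇ))
... | inj₂ mᵃ | inj₁ eᵇ =
  subst (Enumeration (Branching ws))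
    (trans (sym (+-identityʳ _)) (trans (cong (λ rs → length (residual a ws) + length rs) (sym eᵇ)) (length-residuals ws len)))
    (enumeration-∷ a (Branching-∷⁺ ws) (Branching-one-sided ws (λ ()) eᵇ)
      (branching-enumeration n (residual a ws) (residual-unique a ws u) (residual-ofLength a ws len) mᵃ))
... | inj₂ mᵃ@(wᵃ , wᵃ∈) | inj₂ mᵇ@(wᵇ , wᵇ∈) =
  subst (Enumeration (Branching ws)) (length-residuals ws len)
    (enumeration-join {Branching ws} (Branching-∷⁺ ws) (Branching-∷⁻ ws) (Branching-∷⁺ ws) (Branching-∷⁻ ws)
      (λ { a → wᵃ , ∈-residual⁻ ws wᵃ∈ ; b → wᵇ , ∈-residual⁻ ws wᵇ∈ })
      (branching-enumeration n (residual a ws) (residual-unique a ws u) (residual-ofLength a ws len) mᵃ)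
      (branching-enumeration n (residual b ws) (residual-unique b ws u) (residual-ofLength b ws len) mᵇ))

-- By separation the `p` windows of length `n` are distinct leaves of a trie. Its branching nodes
-- are the right special words: these are shorter than `n`, so each of them followed by either
-- letter is a prefix of a window.
RightSpecial-enumeration : ∀ {n p f} .{{_ : NonZero p}} → HasPeriod p f → Separated n p f →
  Enumeration (RightSpecial f) p
RightSpecial-enumeration {n} {p@(suc _)} {f} per sep =
  subst (Enumeration (RightSpecial f)) (length-applyUpTo window p)
    (enumeration-cong sound complete (branching-enumeration n windows unique lengths (window 0 , here refl)))
  where
  window : ℕ → Word
  window i = applyUpTo (shift i f) n
  windows = applyUpTo window p
  unique : Unique windows
  unique = Unique.applyUpTo⁺₁ window p λ {i} {j} i<j j<p eq →
    <⇒≢ i<j (%-injective-< (<-trans i<j j<p) j<p (sep i j (applyUpTo-cong⁻ n eq)))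
  lengths : OfLength n windows
  lengths = All.applyUpTo⁺₂ window p λ i → length-applyUpTo (shift i f) n
  occ : ∀ v {x s} → v ++ x ∷ s ∈ windows → Occ f (v ++ x ∷ [])
  occ v {x} {s} m with i , _ , eq ← ∈-applyUpTo⁻ window m =
    i , startsWith-prefix (shift i f) (v ++ x ∷ []) s n (trans (++-assoc v (x ∷ []) s) eq)
  sound : ∀ {v} → Branching windows v → RightSpecial f v
  sound {v} br = occ v (proj₂ (br a)) , occ v (proj₂ (br b))
  extend : ∀ v {x} → length v < n → Occ f (v ++ x ∷ []) → ∃ λ s → v ++ x ∷ s ∈ windows
  extend v {x} v<n o with i , i<p , eq ← Occ-% per o
    with s , eq′ ← startsWith-extend (shift i f) (v ++ x ∷ []) n (≤-trans (≤-reflexive (length-∷ʳ v x)) v<n) eq =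
    s , subst (_∈ windows) (trans (sym eq′) (++-assoc v (x ∷ []) s)) (∈-applyUpTo⁺ window i<p)
  complete : ∀ {v} → RightSpecial f v → Branching windows v
  complete {v} rs@(oa , ob) a = extend v (RightSpecial-length per sep rs) oa
  complete {v} rs@(oa , ob) b = extend v (RightSpecial-length per sep rs) ob

-- Cutting a periodic stream at its longest coincidence

wrap : (d : ℕ) → .{{NonZero d}} → Stream → Stream
wrap d f t = f (t % d)

wrap-period : ∀ d f .{{_ : NonZero d}} → HasPeriod d (wrap d f)
wrap-period d f t = cong f (trans (%-congˡ {o = d} (+-comm d t)) ([m+n]%n≡m%n t d))

-- The first `d` letters of `g` are closed up into a circle `h`. The word of length `k` at 0 recurs
-- at `d`, so windows of length `k + 1` do not notice the seam.
module Wrap (g : Stream) (p d k : ℕ) .{{_ : NonZero p}} .{{_ : NonZero d}} (d<p : d < p)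
  (sep : Separated (suc k) p g) (coincide : ∀ t → t < k → g t ≡ g (d + t)) where

  private
    h = wrap d g

  -- From `d` on, one turn is dropped at a time: `h` goes back by its period, `g` by the
  -- coincidence.
  wrap-agrees : ∀ s → s < d + k → h s ≡ g s
  wrap-agrees = <-rec _ go
    where
    go : ∀ s → (∀ {r} → r < s → r < d + k → h r ≡ g r) → s < d + k → h s ≡ g s
    go s ih s<d+k with s <? d
    ... | yes s<d = cong g (m<n⇒m%n≡m s<d)
    ... | no s≮d = begin
      h s               ≡⟨ cong h (sym d+t≡s) ⟩
      h (d + t)         ≡⟨ wrap-period d g t ⟩
      h t               ≡⟨ ih (subst (t <_) d+t≡s (m<n+m t (>-nonZero⁻¹ d))) (<-≤-trans t<k (m≤n+m k d)) ⟩
      g t               ≡⟨ coincide t t<k ⟩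
      g (d + t)         ≡⟨ cong g d+t≡s ⟩
      g s               ∎
      where
      open ≡-Reasoning
      t = s ∸ d
      d+t≡s : d + t ≡ s
      d+t≡s = m+[n∸m]≡n (≮⇒≥ s≮d)
      t<k : t < k
      t<k = +-cancelˡ-< d t k (subst (_< d + k) (sym d+t≡s) s<d+k)

  -- A window of length `k + 1` that starts before `d` ends before `d + k`.
  wrap-agrees-from : ∀ {i t} → i < d → t < suc k → h (i + t) ≡ g (i + t)
  wrap-agrees-from i<d (s≤s t≤k) = wrap-agrees _ (+-mono-<-≤ i<d t≤k)

  wrap-separated : Separated (suc k) d h
  wrap-separated i j ag = %-injective-< (<-trans (m%n<n i d) d<p) (<-trans (m%n<n j d) d<p)
    (sep (i % d) (j % d) λ t t<1+k → begin
      g (i % d + t)   ≡⟨ sym (wrap-agrees-from (m%n<n i d) t<1+k) ⟩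
      h (i % d + t)   ≡⟨ Agree-% (wrap-period d g) ag t t<1+k ⟩
      h (j % d + t)   ≡⟨ wrap-agrees-from (m%n<n j d) t<1+k ⟩
      g (j % d + t)   ∎)
    where open ≡-Reasoning

  wrap-Occ : ∀ {v} → length v ≤ suc k → Occ h v → ∃ λ i → i < d × shift i g startsWith v
  wrap-Occ |v|≤ o with i , i<d , eq ← Occ-% (wrap-period d g) o =
    i , i<d , startsWith-resp {shift i h} (λ t t<|v| → wrap-agrees-from i<d (<-≤-trans t<|v| |v|≤)) eq

  -- Right special words of `h` have length at most `k`, so all four extensions have length at most
  -- `k + 1`, where occurrences in `h` are occurrences in `g`.
  wrap-fork : ∀ {v} → ForkOf h v → ForkOf g v
  wrap-fork {v} fk@(rs@(va , vb) , av , bv) =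
    (occ (v∷ʳ≤ a) va , occ (v∷ʳ≤ b) vb) , occ v< av , occ v< bv
    where
    occ : ∀ {w} → length w ≤ suc k → Occ h w → Occ g w
    occ |w|≤ o with i , _ , eq ← wrap-Occ |w|≤ o = i , eq
    v< : suc (length v) ≤ suc k
    v< = RightSpecial-length (wrap-period d g) wrap-separated rs
    v∷ʳ≤ : ∀ x → length (v ++ x ∷ []) ≤ suc k
    v∷ʳ≤ x = ≤-trans (≤-reflexive (length-∷ʳ v x)) v<

  -- By separation `v` occurs in `g` only at positions congruent to `d` modulo `p`, whereas
  -- occurrences in `h` come from starts below `d`.
  wrap-excludes : ∀ {v} → length v ≡ suc k → shift d g startsWith v → ¬ Occ h v
  wrap-excludes {v} |v|≡ atd o with i , i<d , ati ← wrap-Occ (≤-reflexive |v|≡) o =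
    <⇒≢ i<d (%-injective-< (<-trans i<d d<p) d<p (sep i d λ t t<1+k →
      startsWith-agree {shift i g} ati atd t (≤-trans t<1+k (≤-reflexive (sym |v|≡)))))

  -- Of the two right extensions of `v`, the one read in `g` at position `d` is missing from `h`.
  wrap-not-fork : ∀ {v} → length v ≡ k → shift d g startsWith v → ¬ ForkOf h v
  wrap-not-fork {v} |v|≡ atd ((va , vb) , _) =
    wrap-excludes (trans (length-∷ʳ v (g (d + length v))) (cong suc |v|≡))
      (startsWith-∷ʳ⁺ (shift d g) v atd refl) (occ (g (d + length v)))
    where
    occ : ∀ x → Occ h (v ++ x ∷ [])
    occ a = va
    occ b = vb

-- Cyclic words, their sizes and their splittings.

nonempty-suffixes : Word → List Word
nonempty-suffixes [] = []
nonempty-suffixes (x ∷ v) = (x ∷ v) ∷ nonempty-suffixes v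

length-nonempty-suffixes : ∀ v → length (nonempty-suffixes v) ≡ length v
length-nonempty-suffixes [] = refl
length-nonempty-suffixes (x ∷ v) = cong suc (length-nonempty-suffixes v)

∈-nonempty-suffixes : ∀ y {x v} → x ∷ v ∈ nonempty-suffixes (y ++ x ∷ v)
∈-nonempty-suffixes [] = here refl
∈-nonempty-suffixes (_ ∷ y) = there (∈-nonempty-suffixes y)

-- Separation at some depth makes `size` the least period. The depth is a separate field because a
-- piece of a splitting is separated at a depth that is not tied to its size.
record CyclicWord : Set where
  field
    stream    : Stream
    size      : ℕ
    .{{nonZero}} : NonZero size
    depth     : ℕ
    periodic  : HasPeriod size stream
    separated : Separated depth size stream

open CyclicWord using (stream; size)

IsFork : CyclicWord → Word → Set
IsFork W = ForkOf (stream W)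

IsFork? : ∀ W v → Dec (IsFork W v)
IsFork? W = ForkOf? (CyclicWord.periodic W)
  where open CyclicWord W using (nonZero)

right-special-enumeration : ∀ W → Enumeration (RightSpecial (stream W)) (size W)
right-special-enumeration W = RightSpecial-enumeration (CyclicWord.periodic W) (CyclicWord.separated W)
  where open CyclicWord W using (nonZero)

right-special⇒suffix-of-fork : ∀ W {v} → RightSpecial (stream W) v → ForkWithSuffix (stream W) v
right-special⇒suffix-of-fork W = RightSpecial⇒suffix-of-fork (CyclicWord.periodic W) (CyclicWord.separated W)
  where open CyclicWord W using (nonZero)

-- Right special words number `size - 1` and are the suffixes of forks, so the forks control the
-- size.
size-mono : ∀ V W → (∀ {v} → IsFork V v → IsFork W v) → size V ≤ size W
size-mono V W forks
  with Rᵛ , uᵛ , lenᵛ , ⇒ᵛ , _ ← right-special-enumeration V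
     | Rʷ , _ , lenʷ , _ , ⇐ʷ ← right-special-enumeration W =
  subst₂ _≤_ lenᵛ lenʷ (s≤s (Unique-⊆⇒length≤ uᵛ (λ m → ⇐ʷ (transfer (⇒ᵛ m)))))
  where
  transfer : ∀ {v} → RightSpecial (stream V) v → RightSpecial (stream W) v
  transfer rs with z , y , fk , refl ← right-special⇒suffix-of-fork V rs =
    RightSpecial-suffix (stream W) y (proj₁ (forks fk))

-- A right special word of `W` is a suffix of a fork other than `w`, hence right special in `V`, or
-- a suffix of `w`. The empty suffix is charged to `V`, where it is right special as soon as `V` has
-- a fork; without this saving the bound would be one too weak for `distinguished`.
size-≤-+ : ∀ V W w → ∃ (IsFork V) → (∀ {v} → IsFork W v → v ≢ w → IsFork V v) →
  size W ≤ size V + length w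
size-≤-+ V W w (z₀ , fk₀) forks
  with Rᵛ , _ , lenᵛ , _ , ⇐ᵛ ← right-special-enumeration V
     | Rʷ , uʷ , lenʷ , ⇒ʷ , _ ← right-special-enumeration W = begin
  size W                                         ≡⟨ sym lenʷ ⟩
  suc (length Rʷ)                                ≤⟨ s≤s (Unique-⊆⇒length≤ uʷ (λ m → cover ⇐ᵛ (⇒ʷ m))) ⟩
  suc (length (Rᵛ ++ nonempty-suffixes w))       ≡⟨ cong suc (length-++ Rᵛ) ⟩
  suc (length Rᵛ) + length (nonempty-suffixes w) ≡⟨ cong₂ _+_ lenᵛ (length-nonempty-suffixes w) ⟩
  size V + length w                              ∎
  where
  open ≤-Reasoning
  []-special : RightSpecial (stream V) []
  []-special = RightSpecial-suffix (stream V) z₀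
    (subst (RightSpecial (stream V)) (sym (++-identityʳ z₀)) (proj₁ fk₀))
  cover-suffix : ∀ {R} y v → (∀ {v} → RightSpecial (stream V) v → v ∈ R) → IsFork W (y ++ v) →
    v ∈ R ++ nonempty-suffixes w
  cover-suffix y v ⇐ fk with (y ++ v) ≟ʷ w
  ... | no ≢w = ∈-++⁺ˡ (⇐ (RightSpecial-suffix (stream V) y (proj₁ (forks fk ≢w))))
  cover-suffix     y []      ⇐ fk | yes _    = ∈-++⁺ˡ (⇐ []-special)
  cover-suffix {R} y (x ∷ v) ⇐ fk | yes refl = ∈-++⁺ʳ R (∈-nonempty-suffixes y)
  cover : ∀ {R v} → (∀ {v} → RightSpecial (stream V) v → v ∈ R) → RightSpecial (stream W) v →
    v ∈ R ++ nonempty-suffixes w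
  cover {v = v} ⇐ rs with _ , y , fk , refl ← right-special⇒suffix-of-fork W rs = cover-suffix y v ⇐ fk

-- The field `distinguished` turns doubling into Fibonacci growth: when the left piece has a fork,
-- the two pieces cannot both keep every fork of `W` other than the pivot.
record Splitting (W : CyclicWord) : Set where
  field
    pivot         : Word
    pivot-fork    : IsFork W pivot
    left right    : CyclicWord
    sizes         : size left + size right ≡ size W
    left-forks    : ∀ {v} → IsFork left v → IsFork W v × v ≢ pivot
    right-forks   : ∀ {v} → IsFork right v → IsFork W v × v ≢ pivot
    distinguished : (∀ {v} → IsFork W v → v ≢ pivot → IsFork left v × IsFork right v) → ¬ ∃ (IsFork left)

split : ∀ W → 1 < size W → Splitting W
split W 1<p with longest-coincidence depth (size W) (stream W) 1<p periodic separated
  where open CyclicWord W using (nonZero; depth; periodic; separated)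
... | k , sep , j , j<p , i , i<j , agree = record
  { pivot = w
  ; pivot-fork = fork
  ; left = left
  ; right = right
  ; sizes = d+e≡p
  ; left-forks = λ fk → ForkOf-shift f i (L.wrap-fork fk) , λ { refl → L.wrap-not-fork |w| w-at-d fk }
  ; right-forks = λ fk → ForkOf-shift f i (ForkOf-shift g d (R.wrap-fork fk))
                       , λ { refl → R.wrap-not-fork |w| w-at-d+e fk }
  ; distinguished = distinguished
  }
  where
  open CyclicWord W using (nonZero) renaming (stream to f; size to p; periodic to f-period)
  d = j ∸ i
  e = p ∸ d
  0<d : 0 < d
  0<d = m<n⇒0<n∸m i<j
  d<p : d < p
  d<p = ≤-<-trans (m∸n≤m j i) j<p
  d+e≡p : d + e ≡ p
  d+e≡p = m+[n∸m]≡n (<⇒≤ d<p)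
  0<e : 0 < e
  0<e = m<n⇒0<n∸m d<p
  e<p : e < p
  e<p = subst (e <_) d+e≡p (m<n+m e 0<d)
  instance
    d-nonZero : NonZero d
    d-nonZero = >-nonZero 0<d
    e-nonZero : NonZero e
    e-nonZero = >-nonZero 0<e
  -- Now the pivot occurs at 0, at `d`, and again at `d + e`, a full period later.
  g = shift i f
  g-period : HasPeriod p g
  g-period = period-shift {f = f} i f-period
  g-separated : Separated (suc k) p g
  g-separated = Separated-shift {f = f} i sep
  i+d : ∀ t → i + (d + t) ≡ j + t
  i+d t = trans (sym (+-assoc i d t)) (cong (_+ t) (m+[n∸m]≡n (<⇒≤ i<j)))
  coincide : ∀ t → t < k → g t ≡ g (d + t)
  coincide t t<k = trans (agree t t<k) (cong f (sym (i+d t)))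
  g-d+e : ∀ t → g (d + (e + t)) ≡ g t
  g-d+e t = trans (cong g (trans (sym (+-assoc d e t)) (cong (_+ t) d+e≡p))) (g-period t)
  -- The right piece runs from `d` to `d + e`, where the pivot recurs, so it can be closed up in the
  -- same way.
  coincide′ : ∀ t → t < k → shift d g t ≡ shift d g (e + t)
  coincide′ t t<k = trans (sym (coincide t t<k)) (sym (g-d+e t))
  not-congruent : ∀ q → ¬ Agree g (suc k) q (q + d)
  not-congruent q ag = <⇒≢ 0<d (%-injective-< (<-trans 0<d d<p) d<p (%-cancelˡ-+ q 0 d p
    (trans (cong (_% p) (+-identityʳ q)) (g-separated q (q + d) ag))))
  module L = Wrap g p d k d<p g-separated coincide
  module R = Wrap (shift d g) p e k e<p (Separated-shift {f = g} d g-separated) coincide′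
  left right : CyclicWord
  left = record { stream = wrap d g ; size = d ; depth = suc k
                ; periodic = wrap-period d g ; separated = L.wrap-separated }
  right = record { stream = wrap e (shift d g) ; size = e ; depth = suc k
                 ; periodic = wrap-period e (shift d g) ; separated = R.wrap-separated }
  w = applyUpTo g k
  |w| : length w ≡ k
  |w| = length-applyUpTo g k
  w-at-0 : g startsWith w
  w-at-0 = startsWith-applyUpTo g k
  w-at-d : shift d g startsWith w
  w-at-d = startsWith-resp {g} (λ t t<|w| → coincide t (subst (t <_) |w| t<|w|)) w-at-0
  w-at-d+e : shift e (shift d g) startsWith w
  w-at-d+e = startsWith-resp {g} (λ t _ → sym (g-d+e t)) w-at-0
  -- Equal next letters would prolong the coincidence to length `k + 1`, against separation.
  g-differ : g k ≢ g (d + k)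
  g-differ eq = not-congruent 0 (Agree-suc {g} coincide eq)
  fork : ForkOf f w
  fork = ForkOf-shift f i
    ( both-letters (λ x → Occ g (w ++ x ∷ [])) (subst (λ n → g n ≢ g (d + n)) (sym |w|) g-differ)
        (0 , startsWith-∷ʳ⁺ g w w-at-0 refl) (d , startsWith-∷ʳ⁺ (shift d g) w w-at-d refl)
    , left-extensions p g-period not-congruent )
    where
    -- The size is generalised so that it can be matched as `suc q`: the letters before the two
    -- occurrences are read at `q` and `q + d`. If they were equal, windows of length `k + 1` would
    -- agree there.
    left-extensions : ∀ p → .{{NonZero p}} → HasPeriod p g → (∀ q → ¬ Agree g (suc k) q (q + d)) →
      Occ g (a ∷ w) × Occ g (b ∷ w)
    left-extensions (suc q) per not-cong = both-letters (λ x → Occ g (x ∷ w)) differ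
      (q , cong₂ _∷_ (cong g (+-identityʳ q)) (startsWith-resp {g} (λ t _ → sym (before t)) w-at-0))
      (q + d , cong₂ _∷_ (cong g (+-identityʳ (q + d))) (startsWith-resp {shift d g} (λ t _ → sym (before-d t)) w-at-d))
      where
      before : ∀ t → g (q + suc t) ≡ g t
      before t = trans (cong g (+-suc q t)) (per t)
      before-d : ∀ t → g (q + d + suc t) ≡ g (d + t)
      before-d t = trans (cong g (trans (+-suc (q + d) t) (cong suc (+-assoc q d t)))) (per (d + t))
      differ : g q ≢ g (q + d)
      differ eq = not-cong q λ
        { zero _ → trans (cong g (+-identityʳ q)) (trans eq (cong g (sym (+-identityʳ (q + d)))))
        ; (suc t) (s≤s t<k) → trans (before t) (trans (coincide t t<k) (sym (before-d t))) }
  distinguished : (∀ {v} → ForkOf f v → v ≢ w → IsFork left v × IsFork right v) → ¬ ∃ (IsFork left)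
  -- Equal fork sets give `d ≡ e`, so `2d` is a period. As `d ≤ k`, position `k` is `d + t`; the
  -- coincidence carries it back to `t`, and the period carries `t` to `2d + t`, which is `d + k`.
  distinguished forks some = g-differ (begin
    g k                     ≡⟨ cong g (sym d+t≡k) ⟩
    g (d + t)               ≡⟨ sym (coincide t t<k) ⟩
    g t                     ≡⟨ sym (g-d+e t) ⟩
    g (d + (e + t))         ≡⟨ cong (λ n → g (d + (n + t))) (sym d≡e) ⟩
    g (d + (d + t))         ≡⟨ cong (λ n → g (d + n)) d+t≡k ⟩
    g (d + k)               ∎)
    where
    open ≡-Reasoning
    d≡e : d ≡ e
    d≡e = ≤-antisym
      (size-mono left right λ fk → proj₂ (forks (ForkOf-shift f i (L.wrap-fork fk))
        λ { refl → L.wrap-not-fork |w| w-at-d fk }))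
      (size-mono right left λ fk → proj₁ (forks (ForkOf-shift f i (ForkOf-shift g d (R.wrap-fork fk)))
        λ { refl → R.wrap-not-fork |w| w-at-d+e fk }))
    e≤k : e ≤ k
    e≤k = +-cancelˡ-≤ d e k (subst₂ _≤_ (sym d+e≡p) (cong (d +_) |w|)
      (size-≤-+ left W w some λ fk v≢w → proj₁ (forks fk v≢w)))
    t = k ∸ d
    d+t≡k : d + t ≡ k
    d+t≡k = m+[n∸m]≡n (subst (_≤ k) (sym d≡e) e≤k)
    t<k : t < k
    t<k = subst (t <_) d+t≡k (m<n+m t 0<d)

-- The Fibonacci bound

0<F : ∀ n → 0 < F n
0<F zero = z<s
0<F (suc zero) = z<s
0<F (suc (suc n)) = ≤-trans (0<F (suc n)) (m≤m+n _ _)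

-- Here `n` bounds the length of any list containing the forks; in this form the claim passes to the
-- pieces by deleting entries of `L`.
Bound : ℕ → Set
Bound n = ∀ W L → length L ≤ n → (∀ {v} → IsFork W v → v ∈ L) → size W ≤ F (suc n)

module _ {W : CyclicWord} (S : Splitting W) (L : List Word) (forks : ∀ {v} → IsFork W v → v ∈ L) where
  open Splitting S

  private
    L′ = remove pivot L

    |L′|≤ : ∀ {n} → length L ≤ suc n → length L′ ≤ n
    |L′|≤ |L|≤ = ≤-pred (≤-trans (length-remove L (forks pivot-fork)) |L|≤)

    left-L′ : ∀ {v} → IsFork left v → v ∈ L′
    left-L′ fk with fk′ , v≢w ← left-forks fk = ∈-remove (forks fk′) v≢w

    right-L′ : ∀ {v} → IsFork right v → v ∈ L′
    right-L′ fk with fk′ , v≢w ← right-forks fk = ∈-remove (forks fk′) v≢w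

  -- Without the pivot no forks remain, so both pieces have size at most `F 1`; as `F 0 = F 1`, the
  -- sum is `F 2`.
  bound-base : Bound 0 → length L ≤ 1 → size W ≤ F 2
  bound-base bound₀ |L|≤ = subst (_≤ F 2) sizes
    (+-mono-≤ (bound₀ left L′ (|L′|≤ |L|≤) left-L′) (bound₀ right L′ (|L′|≤ |L|≤) right-L′))

  bound-step : ∀ {n} → Bound n → Bound (suc n) → length L ≤ 2 + n → size W ≤ F (3 + n)
  bound-step {n} boundₙ boundₙ₊₁ |L|≤ = subst (_≤ F (3 + n)) sizes pieces
    where
    left-bound : size left ≤ F (2 + n)
    left-bound = boundₙ₊₁ left L′ (|L′|≤ |L|≤) left-L′
    right-bound : size right ≤ F (2 + n)
    right-bound = boundₙ₊₁ right L′ (|L′|≤ |L|≤) right-L′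
    -- A piece that misses an entry of `L′` has its forks in a list of at most `n` entries, so the
    -- index drops by two.
    smaller-bound : ∀ V → (∀ {v} → IsFork V v → v ∈ L′) → ¬ All (IsFork V) L′ → size V ≤ F (suc n)
    smaller-bound V V-L′ ¬all = boundₙ V (filter (IsFork? V) L′)
      (≤-pred (≤-trans (filter-notAll (IsFork? V) L′ (All.¬All⇒Any¬ (IsFork? V) L′ ¬all)) (|L′|≤ |L|≤)))
      λ fk → ∈-filter⁺ (IsFork? V) (V-L′ fk) fk
    pieces : size left + size right ≤ F (3 + n)
    pieces with All.all? (IsFork? left) L′ | All.all? (IsFork? right) L′ | empty-or-member L′
    ... | no ¬all | _ | _ =
      ≤-trans (+-mono-≤ (smaller-bound left left-L′ ¬all) right-bound) (≤-reflexive (+-comm (F (suc n)) _))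
    ... | yes _ | no ¬all | _ = +-mono-≤ left-bound (smaller-bound right right-L′ ¬all)
    -- Both tests hold vacuously here, but the right piece has no fork and `boundₙ` applies with the
    -- empty list.
    ... | yes _ | yes _ | inj₁ L′≡[] =
      +-mono-≤ left-bound (boundₙ right [] z≤n λ fk → subst (_ ∈_) L′≡[] (right-L′ fk))
    ... | yes allˡ | yes allʳ | inj₂ (z , z∈L′) =
      contradiction (z , All.lookup allˡ z∈L′) (distinguished λ fk v≢w →
        let v∈L′ = ∈-remove (forks fk) v≢w in All.lookup allˡ v∈L′ , All.lookup allʳ v∈L′)

small-or-split : ∀ n W → size W ≤ F n ⊎ Splitting W
small-or-split n W with 1 <? size W
... | no 1≮p  = inj₁ (≤-trans (≮⇒≥ 1≮p) (0<F n))
... | yes 1<p = inj₂ (split W 1<p)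

-- Size 1 is within every bound. If no fork is allowed, a larger size is impossible, since splitting
-- would exhibit the pivot as a fork.
size≤F : ∀ n → Bound n
size≤F n W L |L|≤ forks with small-or-split (suc n) W
size≤F n W L |L|≤ forks | inj₁ small = small
size≤F zero W [] |L|≤ forks | inj₂ S = ⊥-elim (∉[] (forks (Splitting.pivot-fork S)))
size≤F (suc zero) W L |L|≤ forks | inj₂ S = bound-base S L forks (size≤F 0) |L|≤
size≤F (suc (suc n)) W L |L|≤ forks | inj₂ S = bound-step S L forks (size≤F n) (size≤F (suc n)) |L|≤

-- From finite words to streams

-- The default `a` past the end is never read, since `wrap` reduces the index below the length.
letter : Word → ℕ → X
letter [] _ = a
letter (x ∷ u) zero = x
letter (x ∷ u) (suc t) = letter u t

applyUpTo-letter : ∀ u → applyUpTo (letter u) (length u) ≡ u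
applyUpTo-letter [] = refl
applyUpTo-letter (x ∷ u) = cong (x ∷_) (applyUpTo-letter u)

module _ (p : ℕ) .{{p-nonZero : NonZero p}} (f : Stream) (per : HasPeriod p f) where

  Occ⇒Subword : ∀ {v} → Occ f v → SubwordOfPow∞ (applyUpTo f p) v
  Occ⇒Subword {v} (i , eq) = k , applyUpTo f i , applyUpTo (shift (i + length v) f) r , (begin
    applyUpTo f i ++ v ++ s                                       ≡⟨ sym (++-assoc _ v s) ⟩
    (applyUpTo f i ++ v) ++ s                                     ≡⟨ cong (λ w → (applyUpTo f i ++ w) ++ s) (sym eq) ⟩
    (applyUpTo f i ++ applyUpTo (shift i f) (length v)) ++ s      ≡⟨ cong (_++ s) (sym (applyUpTo-+ f i (length v))) ⟩
    applyUpTo f (i + length v) ++ s                               ≡⟨ sym (applyUpTo-+ f (i + length v) r) ⟩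
    applyUpTo f (i + length v + r)                                ≡⟨ cong (applyUpTo f) (m+[n∸m]≡n (m≤m*n k p)) ⟩
    applyUpTo f (k * p)                                           ≡⟨ applyUpTo-power per k ⟩
    applyUpTo f p ^ʷ k                                            ∎)
    where
    open ≡-Reasoning
    -- As `p` is at least 1, `k` copies of the period have at least `k` letters, enough to contain
    -- the occurrence.
    k = i + length v
    r = k * p ∸ k
    s = applyUpTo (shift (i + length v) f) r

  ForkOf⇒Fork : ∀ {v} → ForkOf f v → Fork (applyUpTo f p) v
  ForkOf⇒Fork ((va , vb) , av , bv) = Occ⇒Subword va , Occ⇒Subword vb , Occ⇒Subword av , Occ⇒Subword bv

  -- A window of length `p` determines all that follows, so agreement at `i` and `j` lasts forever.
  -- Shifting by `i * p`, which is at least `i`, carries it back to position 0.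
  agree⇒period : ∀ {i j} → i < j → Agree f p i j → HasPeriod (j ∸ i) f
  agree⇒period {i} {j} i<j ag t = begin
    f (d + t)                       ≡⟨ sym (period-* per i _) ⟩
    f (i * p + (d + t))             ≡⟨ cong f (lemma₁ (i * p) i (i * p ∸ i) d t (m+[n∸m]≡n (m≤m*n i p))) ⟩
    f (i + d + (i * p ∸ i + t))     ≡⟨ cong (λ n → f (n + (i * p ∸ i + t))) (m+[n∸m]≡n (<⇒≤ i<j)) ⟩
    f (j + (i * p ∸ i + t))         ≡⟨ sym (forever (i * p ∸ i + t)) ⟩
    f (i + (i * p ∸ i + t))         ≡⟨ cong f (trans (sym (+-assoc i _ t)) (cong (_+ t) (m+[n∸m]≡n (m≤m*n i p)))) ⟩
    f (i * p + t)                   ≡⟨ period-* per i t ⟩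
    f t                             ∎
    where
    open ≡-Reasoning
    d = j ∸ i
    lemma₀ : ∀ i r d t → i + r + (d + t) ≡ i + d + (r + t)
    lemma₀ = solve-∀
    lemma₁ : ∀ n i r d t → i + r ≡ n → n + (d + t) ≡ i + d + (r + t)
    lemma₁ _ i r d t refl = lemma₀ i r d t
    reduce : ∀ i t → f (i + t % p) ≡ f (i + t)
    reduce i t = trans (cong f (+-comm i (t % p))) (trans (period-% per t i) (cong f (+-comm t i)))
    forever : ∀ t → f (i + t) ≡ f (j + t)
    forever t = trans (sym (reduce i t)) (trans (ag (t % p) (m%n<n t p)) (reduce j t))

  -- The period `gcd d p` divides `p` and is at most `d`, hence below `p`, so the exponent is at
  -- least 2.
  period⇒Periodic : ∀ {d} → 0 < d → d < p → HasPeriod d f → Periodic (applyUpTo f p)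
  period⇒Periodic {d} 0<d d<p perd with gcd[m,n]∣n d p
  ... | divides q p≡qg = applyUpTo f (gcd d p) , q , 2≤q q p≡qg ,
    trans (cong (applyUpTo f) p≡qg) (applyUpTo-power (period-gcd perd per) q)
    where
    g≤d : gcd d p ≤ d
    g≤d = ∣⇒≤ {{>-nonZero 0<d}} (gcd[m,n]∣m d p)
    2≤q : ∀ q → p ≡ q * gcd d p → 2 ≤ q
    2≤q zero eq = contradiction d<p (λ d<p → n≮0 (subst (d <_) eq d<p))
    2≤q (suc zero) eq = contradiction (≤-trans (≤-reflexive (trans eq (*-identityˡ _))) g≤d) (<⇒≱ d<p)
    2≤q (suc (suc q)) eq = s≤s (s≤s z≤n)

  NonPeriodic⇒Separated : NonPeriodic (applyUpTo f p) → Separated p p f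
  NonPeriodic⇒Separated np with separated-or-coincidence p p f per
  ... | inj₁ sep = sep
  ... | inj₂ (j , j<p , i , i<j , ag) = contradiction
    (period⇒Periodic (m<n⇒0<n∸m i<j) (≤-<-trans (m∸n≤m j i) j<p) (agree⇒period i<j ag)) np

theorem2p10 : (u : Word) (n : ℕ) → u ≢ [] → NonPeriodic u →
    HasExactlyForks u n → length u ≤ F (suc n)
theorem2p10 [] n u≢[] _ _ = contradiction refl u≢[]
theorem2p10 u@(_ ∷ u′) n _ np (L , _ , |L|≡n , forks) =
  size≤F n W L (≤-reflexive |L|≡n) λ {v} fk →
    proj₁ (forks v) (subst (λ u → Fork u v) f-spells-u (ForkOf⇒Fork p f (wrap-period p (letter u)) fk))
  where
  p = length u
  f = wrap p (letter u)
  f-spells-u : applyUpTo f p ≡ u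
  f-spells-u = trans (applyUpTo-cong {f} p λ t t<p → cong (letter u) (m<n⇒m%n≡m t<p)) (applyUpTo-letter u)
  W : CyclicWord
  W = record { stream = f ; size = p ; depth = p ; periodic = wrap-period p (letter u)
             ; separated = NonPeriodic⇒Separated p f (wrap-period p (letter u)) (subst NonPeriodic (sym f-spells-u) np) }
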